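{- Let $\wp$ be a behavioral quantifier prefix with pairwise distinct propositions and let $\Psi\subseteq\mathrm{Asg}(\mathrm{ap}(\wp))$ be Borelian. Then the quantification game $\mathcal G_{\wp,\Psi}$ satisfies: (1) if Eloise wins $\mathcal G_{\wp,\Psi}$, then there exists $E\in\mathrm{evl}_{\exists\forall}(C_{\forall\exists}(\wp))$ with $E\subseteq\Psi$; (2) if Abelard wins $\mathcal G_{\wp,\Psi}$, then $E\not\subseteq\Psi$ for every $E\in\mathrm{evl}_{\exists\forall}(C_{\exists\forall}(\wp))$.
   Context: Let $AP$ be a set of atomic propositions and $\mathbb B=\{\top,\bot\}$. A temporal valuation is a function $f:\mathbb N\to\mathbb B$. An assignment is a partial function $\chi:AP\rightharpoonup(\mathbb N\to\mathbb B)$; $\mathrm{Asg}$ is the set of all assignments, $\mathrm{Asg}(P)$ the set of assignments with domain exactly $P\subseteq AP$. For an assignment $\chi$, $p\in AP$ and a temporal valuation $f$, $\chi[p\mapsto f]$ is the assignment that agrees with $\chi$ except that it maps $p$ to $f$. A hyperassignment is a set $\mathcal X$ with $\emptyset\neq\mathcal X\subseteq 2^{\mathrm{Asg}(P)}$ and $\emptyset\notin\mathcal X$, for some $P\subseteq AP$; this $P$ is denoted $\mathrm{ap}(\mathcal X)$. A choice function for $\mathcal X$ is a map $c:\mathcal X\to\mathrm{Asg}$ with $c(X)\in X$ for all $X\in\mathcal X$. The dual of $\mathcal X$ is $\overline{\mathcal X}=\{\mathrm{img}(c): c\text{ a choice function for }\mathcal X\}$. A functor over $P\subseteq AP$ is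 a function $F:\mathrm{Asg}(P)\to(\mathbb N\to\mathbb B)$; $\mathrm{Fnc}(P)$ is the set of all of them. $\mathrm{ext}(\chi,F,p)=\chi[p\mapsto F(\chi)]$ and $\mathrm{ext}(X,F,p)=\{\mathrm{ext}(\chi,F,p):\chi\in X\}$. For $\chi_1,\chi_2\in\mathrm{Asg}(P)$, $p\in P$, $k\in\mathbb N$: $\chi_1\approx^{>k}_p\chi_2$ iff $\chi_1(q)=\chi_2(q)$ for all $q\in P\setminus\{p\}$ and $\chi_1(p)(t)=\chi_2(p)(t)$ for all $t\le k$; $\chi_1\approx^{\ge k}_p\chi_2$ is defined the same way with $t<k$ in place of $t\le k$. $F\in\mathrm{Fnc}(P)$ is behavioral (resp. strongly behavioral) w.r.t. $p\in P$ if $F(\chi_1)(k)=F(\chi_2)(k)$ for all $k\in\mathbb N$ and all $\chi_1,\chi_2$ with $\chi_1\approx^{>k}_p\chi_2$ (resp. $\chi_1\approx^{\ge k}_p\chi_2$). A quantifier specification is a pair $\sigma=\langle P_B,P_S\rangle$ of subsets of $AP$; $\mathrm{Fnc}_\sigma(P)$ is the set of $F\in\mathrm{Fnc}(P)$ that are behavioral w.r.t. every $p\in P_B\cap P$ and strongly behavioral w.r.t. every $p\in P_S\cap P$. $\mathrm{ext}_\sigma(\mathcal X,p)=\{\mathrm{ext}(X,F,p):X\in\mathcal X,\ F\in\mathrm{Fnc}_\sigma(\mathrm{ap}(\mathcal X))\}$. Union of specifications is componentwise. Write $\mathsf B=\langle AP,\emptyset\rangle$. A quantifier prefix is a finite sequence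 $\wp=Q_1^{\sigma_1}p_1\cdots Q_n^{\sigma_n}p_n$ with $Q_i\in\{\exists,\forall\}$; $\mathrm{ap}(\wp)=\{p_1,\dots,p_n\}$, $\epsilon$ is the empty prefix. It is behavioral if every $\sigma_i=\mathsf B$. The quantifier $\exists$ is $\exists\forall$-coherent and $\forall$ is $\forall\exists$-coherent. Evolution: $\mathrm{evl}_\alpha(\mathcal X,Q^\sigma p)=\mathrm{ext}_\sigma(\mathcal X,p)$ if $Q$ is $\alpha$-coherent, and $\overline{\mathrm{ext}_\sigma(\overline{\mathcal X},p)}$ otherwise; $\mathrm{evl}_\alpha(\mathcal X,\epsilon)=\mathcal X$, $\mathrm{evl}_\alpha(\mathcal X,Q^\sigma p.\wp)=\mathrm{evl}_\alpha(\mathrm{evl}_\alpha(\mathcal X,Q^\sigma p),\wp)$, and $\mathrm{evl}_\alpha(\wp)=\mathrm{evl}_\alpha(\{\{\emptyset\}\},\wp)$ with $\emptyset$ the empty assignment. Canonical forms. Every behavioral prefix $\wp$ can be uniquely written as $\exists^{\mathsf B}\vec q_0.\forall^{\mathsf B}\vec p_1.\exists^{\mathsf B}\vec q_1\cdots\forall^{\mathsf B}\vec p_k.\exists^{\mathsf B}\vec q_k.\forall^{\mathsf B}\vec p_{k+1}$ with $k\in\mathbb N$, $\vec q_0,\vec p_{k+1}$ possibly empty and $\vec p_i,\vec q_i$ nonempty for $1\le i\le k$ (where $Q^\sigma\vec p$ quantifies the entries of $\vec p$ in order); then $C_{\exists\forall}(\wp)=\exists^{\mathsf B}\vec q_0\cdots\exists^{\mathsf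 B}\vec q_k.\forall^{\tau_1}\vec p_1\cdots\forall^{\tau_{k+1}}\vec p_{k+1}$ where $\tau_i=\mathsf B\cup\langle\emptyset,\vec q_i\cup\cdots\cup\vec q_k\rangle$ (for $i=k+1$, $\tau_{k+1}=\mathsf B$). Dually, writing $\wp$ uniquely as $\forall^{\mathsf B}\vec p_0.\exists^{\mathsf B}\vec q_1.\forall^{\mathsf B}\vec p_1\cdots\exists^{\mathsf B}\vec q_k.\forall^{\mathsf B}\vec p_k.\exists^{\mathsf B}\vec q_{k+1}$ (with $\vec p_0,\vec q_{k+1}$ possibly empty, the others nonempty), $C_{\forall\exists}(\wp)=\forall^{\mathsf B}\vec p_0\cdots\forall^{\mathsf B}\vec p_k.\exists^{\tau_1}\vec q_1\cdots\exists^{\tau_{k+1}}\vec q_{k+1}$ with $\tau_i=\mathsf B\cup\langle\emptyset,\vec p_i\cup\cdots\cup\vec p_k\rangle$. Words and Borel sets. For finite $P\subseteq AP$, $\mathrm{Val}(P)$ is the set of maps $P\to\mathbb B$; the word function $w:\mathrm{Asg}(P)\to\mathrm{Val}(P)^\omega$, $w(\chi)_t(p)=\chi(p)(t)$, is a bijection. $\Psi\subseteq\mathrm{Asg}(P)$ is Borelian if $w(\Psi)$ is a Borel set in the product (Cantor) topology on $\mathrm{Val}(P)^\omega$. Games. A game consists of disjoint sets of positions of Eloise and Abelard, an initial position, a move relation in which every position has a successor, a set $O$ of observable positions and a winning set $W\subseteq O^\omega$. A history is a finite path from the initial position; a strategy for a player maps each history ending in one of its positions to a successor of that position; a pair of strategies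 induces a unique infinite play; the observation of a play is the sequence of observable positions occurring in it, in order. Eloise wins if she has a strategy such that for every Abelard strategy the observation of the induced play lies in $W$; Abelard wins if he has a strategy such that for every Eloise strategy the observation is not in $W$. Quantification game $\mathcal G_{\wp,\Psi}$ for a behavioral prefix $\wp=Q_1^{\mathsf B}p_1\cdots Q_n^{\mathsf B}p_n$ (distinct $p_i$) and $\Psi\subseteq\mathrm{Asg}(\mathrm{ap}(\wp))$: positions are the valuations $v$ with domain $\{p_1,\dots,p_m\}$ for some $0\le m\le n$ ($m=|\mathrm{dom}(v)|$); $v$ belongs to Eloise iff $m<n$ and $Q_{m+1}=\exists$, otherwise to Abelard; the initial position is the empty valuation; moves go from $v$ with $m<n$ to any extension of $v$ with domain $\{p_1,\dots,p_{m+1}\}$, and from every total valuation ($m=n$) to the empty valuation; the observable positions are the total valuations $\mathrm{Val}(\mathrm{ap}(\wp))$; the winning set is $W=w(\Psi)$. -}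

module Defs where

open import Data.Bool.Base using (Bool; true; false; T; if_then_else_; _∨_)
open import Data.Bool.Properties using (∨-identityʳ; ∨-assoc)
open import Data.List.Base using (List; []; _∷_; _++_; map; concatMap; take; drop; length)
open import Data.List.NonEmpty.Base using (List⁺; _∷_; _∷⁺_; toList)
open import Data.List.Properties using (++-assoc)
open import Data.List.Relation.Unary.All using (All; []; _∷_)
open import Data.Maybe.Base as Maybe using (Maybe; just; nothing; is-just)
open import Data.Nat.Base using (ℕ; zero; suc; _≤_; _<_; z≤n; s≤s)
open import Data.Nat.Properties using (m≤n⇒m<n∨m≡n)
open import Data.Product.Base using (Σ-syntax; ∃; ∃-syntax; _×_; _,_; proj₁; proj₂)
open import Data.Sum.Base using (inj₁; inj₂)
open import Function.Base using (_∘_; const)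
open import Level using (0ℓ)
open import Relation.Binary.Definitions using (DecidableEquality)
open import Relation.Binary.PropositionalEquality
  using (_≡_; _≢_; _≗_; refl; sym; trans; cong)
open import Relation.Nullary.Decidable using (does)
open import Relation.Nullary.Negation using (¬_)
open import Relation.Unary using (Pred; _∈_; _∉_; _⊆_; _≐_; ⋃)

-- In the presence of excluded middle and function extensionality, A → Bool is
-- the full (extensional) powerset of A.  Unlike Pred A 0ℓ it stays in Set, so
-- that it can be iterated and quantified over without raising the level.
𝒫 : Set → Set
𝒫 A = A → Bool

⟦_⟧ : {A : Set} → 𝒫 A → Pred A 0ℓ
⟦ S ⟧ x = T (S x)

------------------------------------------------------------------------
-- Games

data Player : Set where
  Eloise Abelard : Player

record Game : Set₁ where
  field
    Pos        : Set
    owner      : Pos → Player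
    initial    : Pos
    _⟶_        : Pos → Pos → Set
    successor  : ∀ v → ∃[ v′ ] v ⟶ v′
    Observable : Pred Pos 0ℓ
    Win        : Pred (ℕ → ∃ Observable) 0ℓ

  -- Histories are indexed by their last position.
  data History : Pos → Set where
    start : History initial
    _▷_   : ∀ {v v′} → History v → v ⟶ v′ → History v′

  Strategy : Player → Set
  Strategy a = ∀ {v} → History v → owner v ≡ a → ∃[ v′ ] v ⟶ v′

  module _ (s : Strategy Eloise) (t : Strategy Abelard) where

    respond : ∀ {v} → History v → (a : Player) → owner v ≡ a → ∃[ v′ ] v ⟶ v′
    respond h Eloise  eq = s h eq
    respond h Abelard eq = t h eq

    history : ℕ → ∃ History
    history zero    = initial , start
    history (suc i) =
      let v , h = history i ; v′ , m = respond h (owner v) refl in v′ , h ▷ m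

    play : ℕ → Pos
    play i = proj₁ (history i)

  -- e enumerates, in increasing order, the times at which the play is in an
  -- observable position.  A play with finitely many of these has no infinite
  -- observation, hence none that belongs to Win.
  IsObservation : (ℕ → Pos) → (ℕ → ∃ Observable) → Set
  IsObservation π u = Σ[ e ∈ (ℕ → ℕ) ]
    (∀ i → e i < e (suc i)) ×
    (∀ i → proj₁ (u i) ≡ π (e i)) ×
    (∀ t → Observable (π t) → ∃[ i ] e i ≡ t)

  ObservationWins : (ℕ → Pos) → Set
  ObservationWins π = ∃[ u ] IsObservation π u × u ∈ Win

  EloiseWins : Set
  EloiseWins = Σ[ s ∈ Strategy Eloise ] (∀ (t : Strategy Abelard) → ObservationWins (play s t))

  AbelardWins : Set
  AbelardWins = Σ[ t ∈ Strategy Abelard ] (∀ (s : Strategy Eloise) → ¬ ObservationWins (play s t))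

------------------------------------------------------------------------

data Quantifier : Set where
  ∃′ ∀′ : Quantifier

opposite : Quantifier → Quantifier
opposite ∃′ = ∀′
opposite ∀′ = ∃′

data Alternation : Set where
  ∃∀ ∀∃ : Alternation

coherent : Alternation → Quantifier → Bool
coherent ∃∀ ∃′ = true
coherent ∃∀ ∀′ = false
coherent ∀∃ ∃′ = false
coherent ∀∃ ∀′ = true

module Hyper (AP : Set) (_≟_ : DecidableEquality AP) where

  open import Data.List.Membership.DecPropositional _≟_ using (_∈?_)

  ----------------------------------------------------------------------
  -- Assignments, valuations and words

  Temporal : Set
  Temporal = ℕ → Bool

  Partial : Set → Set
  Partial B = AP → Maybe B

  dom : {B : Set} → Partial B → 𝒫 AP
  dom f p = is-just (f p)

  undefined : {B : Set} → Partial B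
  undefined _ = nothing

  Assignment Valuation : Set
  Assignment = Partial Temporal
  Valuation  = Partial Bool

  Asg : 𝒫 AP → Pred Assignment 0ℓ
  Asg P χ = dom χ ≗ P

  Val : 𝒫 AP → Pred Valuation 0ℓ
  Val P v = dom v ≗ P

  _[_↦_] : Assignment → AP → Temporal → Assignment
  (χ [ p ↦ f ]) q = if does (q ≟ p) then just f else χ q

  word : Assignment → (ℕ → Valuation)
  word χ t p = Maybe.map (λ f → f t) (χ p)

  words : Pred Assignment 0ℓ → Pred (ℕ → Valuation) 0ℓ
  words Ψ u = ∃[ χ ] χ ∈ Ψ × u ≡ word χ

  fromList : List AP → 𝒫 AP
  fromList ps p = does (p ∈? ps)

  ----------------------------------------------------------------------
  -- Borel subsets of Val(P)^ω

  module _ (P : 𝒫 AP) where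

    Words : Pred (ℕ → Valuation) 0ℓ
    Words u = ∀ t → u t ∈ Val P

    -- The product topology, with Val(P) discrete.
    Open : Pred (ℕ → Valuation) 0ℓ → Set
    Open A = A ⊆ Words ×
      (∀ u → u ∈ A → ∃[ n ] (∀ u′ → u′ ∈ Words → (∀ t → t < n → u′ t ≡ u t) → u′ ∈ A))

    data Borel : Pred (ℕ → Valuation) 0ℓ → Set₁ where
      open-set   : ∀ {A} → Open A → Borel A
      complement : ∀ {A} → Borel A → Borel (λ u → u ∈ Words × u ∉ A)
      union      : ∀ {A : ℕ → Pred (ℕ → Valuation) 0ℓ} → (∀ i → Borel (A i)) → Borel (⋃ ℕ A)
      resp       : ∀ {A A′} → A ≐ A′ → Borel A → Borel A′

    Borelian : Pred Assignment 0ℓ → Set₁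
    Borelian Ψ = Borel (words Ψ)

  ----------------------------------------------------------------------
  -- Hyperassignments

  record IsHyperassignment (𝒳 : Pred (𝒫 Assignment) 0ℓ) (P : 𝒫 AP) : Set where
    field
      over      : ∀ {X} → X ∈ 𝒳 → ⟦ X ⟧ ⊆ Asg P
      nonempty  : ∃[ X ] X ∈ 𝒳
      inhabited : ∀ {X} → X ∈ 𝒳 → ∃[ χ ] χ ∈ ⟦ X ⟧

  -- c is a choice function for 𝒳; its values outside 𝒳 are irrelevant.
  Chooses : Pred (𝒫 Assignment) 0ℓ → (𝒫 Assignment → Assignment) → Set
  Chooses 𝒳 c = ∀ X → X ∈ 𝒳 → c X ∈ ⟦ X ⟧

  dual : Pred (𝒫 Assignment) 0ℓ → Pred (𝒫 Assignment) 0ℓ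
  dual 𝒳 Y = ∃[ c ] Chooses 𝒳 c × ⟦ Y ⟧ ≐ (λ χ → ∃[ X ] X ∈ 𝒳 × χ ≡ c X)

  ----------------------------------------------------------------------
  -- Functors

  -- A functor over P is given by a function on all assignments of which only
  -- the restriction to Asg P matters.
  Functor : Set
  Functor = Assignment → Temporal

  -- χ₁ ≈ χ₂ as elements of Asg P, where p is compared only at the times in R.
  Agree : 𝒫 AP → AP → Pred ℕ 0ℓ → Assignment → Assignment → Set
  Agree P p R χ₁ χ₂ =
    (∀ q → q ∈ ⟦ P ⟧ → q ≢ p → χ₁ q ≡ χ₂ q) ×
    (∀ t → t ∈ R → word χ₁ t p ≡ word χ₂ t p)

  Behavioral StronglyBehavioral : 𝒫 AP → AP → Functor → Set
  Behavioral P p F = ∀ k χ₁ χ₂ → χ₁ ∈ Asg P → χ₂ ∈ Asg P →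
    Agree P p (_≤ k) χ₁ χ₂ → F χ₁ k ≡ F χ₂ k
  StronglyBehavioral P p F = ∀ k χ₁ χ₂ → χ₁ ∈ Asg P → χ₂ ∈ Asg P →
    Agree P p (_< k) χ₁ χ₂ → F χ₁ k ≡ F χ₂ k

  record Spec : Set where
    constructor ⟨_,_⟩
    field
      behavioral strong : 𝒫 AP
  open Spec public

  _∪ˢ_ : Spec → Spec → Spec
  ⟨ B , S ⟩ ∪ˢ ⟨ B′ , S′ ⟩ = ⟨ (λ p → B p ∨ B′ p) , (λ p → S p ∨ S′ p) ⟩

  𝖡 : Spec
  𝖡 = ⟨ const true , const false ⟩

  Fnc : Spec → 𝒫 AP → Pred Functor 0ℓ
  Fnc σ P F =
    (∀ p → p ∈ ⟦ behavioral σ ⟧ → p ∈ ⟦ P ⟧ → Behavioral P p F) ×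
    (∀ p → p ∈ ⟦ strong σ ⟧ → p ∈ ⟦ P ⟧ → StronglyBehavioral P p F)

  extend : Assignment → Functor → AP → Assignment
  extend χ F p = χ [ p ↦ F χ ]

  -- For a hyperassignment 𝒳 there is exactly one P as below, namely ap(𝒳).
  ext : Spec → Pred (𝒫 Assignment) 0ℓ → AP → Pred (𝒫 Assignment) 0ℓ
  ext σ 𝒳 p Y = ∃[ P ] IsHyperassignment 𝒳 P × ∃[ X ] ∃[ F ]
    X ∈ 𝒳 × F ∈ Fnc σ P × ⟦ Y ⟧ ≐ (λ χ → ∃[ χ′ ] χ′ ∈ ⟦ X ⟧ × χ ≡ extend χ′ F p)

  ----------------------------------------------------------------------
  -- Quantifier prefixes and their evolution

  record Quantification : Set where
    constructor quant
    field
      kind : Quantifier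
      spec : Spec
      prop : AP
  open Quantification public

  Prefix : Set
  Prefix = List Quantification

  props : Prefix → List AP
  props = map prop

  ap : Prefix → 𝒫 AP
  ap ℘ = fromList (props ℘)

  IsBehavioral : Prefix → Set
  IsBehavioral = All (λ q → spec q ≡ 𝖡)

  evolve₁ : Alternation → Pred (𝒫 Assignment) 0ℓ → Quantification → Pred (𝒫 Assignment) 0ℓ
  evolve₁ α 𝒳 (quant Q σ p) =
    if coherent α Q then ext σ 𝒳 p else dual (ext σ (dual 𝒳) p)

  evolve : Alternation → Pred (𝒫 Assignment) 0ℓ → Prefix → Pred (𝒫 Assignment) 0ℓ
  evolve α 𝒳 []      = 𝒳
  evolve α 𝒳 (q ∷ ℘) = evolve α (evolve₁ α 𝒳 q) ℘

  -- The hyperassignment {{∅}}.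
  trivial : Pred (𝒫 Assignment) 0ℓ
  trivial X = ⟦ X ⟧ ≐ (_≡ undefined)

  evl : Alternation → Prefix → Pred (𝒫 Assignment) 0ℓ
  evl α ℘ = evolve α trivial ℘

  ----------------------------------------------------------------------
  -- Canonical forms

  -- With Q the leading quantifier and Q̄ its opposite, this is
  -- Q x⃗₀. Q̄ y⃗₁. Q x⃗₁ ⋯ Q̄ y⃗ₖ. Q x⃗ₖ. Q̄ y⃗ₖ₊₁, where first = x⃗₀, middle lists the
  -- pairs (y⃗ᵢ , x⃗ᵢ) for 1 ≤ i ≤ k, and last = y⃗ₖ₊₁.
  record Blocks : Set where
    constructor blocks
    field
      first  : List AP
      middle : List (List⁺ AP × List⁺ AP)
      last   : List AP

  quantify : Quantifier → Spec → List AP → Prefix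
  quantify Q σ = map (quant Q σ)

  alternate : Quantifier → List (List⁺ AP × List⁺ AP) → Prefix
  alternate Q = concatMap λ (ys , xs) →
    quantify (opposite Q) 𝖡 (toList ys) ++ quantify Q 𝖡 (toList xs)

  assemble : Quantifier → Blocks → Prefix
  assemble Q (blocks first middle last) =
    quantify Q 𝖡 first ++ alternate Q middle ++ quantify (opposite Q) 𝖡 last

  prepend-same prepend-opposite : AP → Blocks → Blocks
  prepend-same p (blocks first middle last) = blocks (p ∷ first) middle last
  prepend-opposite p (blocks (x ∷ xs) middle           last) =
    blocks [] ((p ∷ [] , x ∷ xs) ∷ middle) last
  prepend-opposite p (blocks []       ((ys , xs) ∷ bs) last) =
    blocks [] ((p ∷⁺ ys , xs) ∷ bs) last
  prepend-opposite p (blocks []       []               last) =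
    blocks [] [] (p ∷ last)

  decompose : Quantifier → Prefix → Blocks
  decompose Q  []                = blocks [] [] []
  decompose ∃′ (quant ∃′ _ p ∷ ℘) = prepend-same p (decompose ∃′ ℘)
  decompose ∃′ (quant ∀′ _ p ∷ ℘) = prepend-opposite p (decompose ∃′ ℘)
  decompose ∀′ (quant ∀′ _ p ∷ ℘) = prepend-same p (decompose ∀′ ℘)
  decompose ∀′ (quant ∃′ _ p ∷ ℘) = prepend-opposite p (decompose ∀′ ℘)

  assemble-opposite : ∀ Q p b →
    assemble Q (prepend-opposite p b) ≡ quant (opposite Q) 𝖡 p ∷ assemble Q b
  assemble-opposite Q p (blocks (x ∷ xs) middle last) =
    cong (λ r → quant (opposite Q) 𝖡 p ∷ quant Q 𝖡 x ∷ r)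
      (++-assoc (quantify Q 𝖡 xs) (alternate Q middle) (quantify (opposite Q) 𝖡 last))
  assemble-opposite Q p (blocks []       (_ ∷ _)      last) = refl
  assemble-opposite Q p (blocks []       []           last) = refl

  assemble-decompose : ∀ Q {℘} → IsBehavioral ℘ → assemble Q (decompose Q ℘) ≡ ℘
  assemble-decompose Q  {[]}               []         = refl
  assemble-decompose ∃′ {quant ∃′ _ p ∷ ℘} (refl ∷ b) =
    cong (_ ∷_) (assemble-decompose ∃′ b)
  assemble-decompose ∃′ {quant ∀′ _ p ∷ ℘} (refl ∷ b) =
    trans (assemble-opposite ∃′ p (decompose ∃′ ℘)) (cong (_ ∷_) (assemble-decompose ∃′ b))
  assemble-decompose ∀′ {quant ∀′ _ p ∷ ℘} (refl ∷ b) =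
    cong (_ ∷_) (assemble-decompose ∀′ b)
  assemble-decompose ∀′ {quant ∃′ _ p ∷ ℘} (refl ∷ b) =
    trans (assemble-opposite ∀′ p (decompose ∀′ ℘)) (cong (_ ∷_) (assemble-decompose ∀′ b))

  leading : List (List⁺ AP × List⁺ AP) → List AP
  leading = concatMap (toList ∘ proj₂)

  -- The spec attached to y⃗ᵢ is τᵢ = 𝖡 ∪ ⟨ ∅ , x⃗ᵢ ∪ ⋯ ∪ x⃗ₖ ⟩.
  trailing : Quantifier → List (List⁺ AP × List⁺ AP) → Prefix
  trailing Q []                 = []
  trailing Q bs@((ys , _) ∷ bs′) =
    quantify (opposite Q) (𝖡 ∪ˢ ⟨ const false , fromList (leading bs) ⟩) (toList ys)
      ++ trailing Q bs′

  canonical : Quantifier → Blocks → Prefix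
  canonical Q (blocks first middle last) =
    quantify Q 𝖡 (first ++ leading middle) ++
    trailing Q middle ++ quantify (opposite Q) 𝖡 last

  -- Meaningful for behavioral prefixes only: the specs of ℘ are disregarded.
  C : Alternation → Prefix → Prefix
  C ∃∀ ℘ = canonical ∃′ (decompose ∃′ ℘)
  C ∀∃ ℘ = canonical ∀′ (decompose ∀′ ℘)

  ----------------------------------------------------------------------
  -- The quantification game

  record Position (℘ : Prefix) : Set where
    field
      size  : ℕ
      size≤ : size ≤ length ℘
      val   : Valuation
      val∈  : val ∈ Val (fromList (take size (props ℘)))
  open Position public

  -- The owner of a valuation, given the part of the prefix still to be played.
  turn : Prefix → Player
  turn (quant ∃′ _ _ ∷ _) = Eloise
  turn (quant ∀′ _ _ ∷ _) = Abelard
  turn []                 = Abelard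

  data Move {℘ : Prefix} (v v′ : Position ℘) : Set where
    assign  : size v < length ℘ → size v′ ≡ suc (size v) →
              (∀ p → p ∈ ⟦ dom (val v) ⟧ → val v′ p ≡ val v p) → Move v v′
    restart : size v ≡ length ℘ → size v′ ≡ 0 → Move v v′

  emptyPosition : ∀ {℘} → Position ℘
  emptyPosition = record { size = 0 ; size≤ = z≤n ; val = undefined ; val∈ = λ _ → refl }

  take-suc : ∀ ℘ m → m < length ℘ → ∃[ p ] (∀ q →
    fromList (take m (props ℘)) q ∨ does (q ≟ p) ≡ fromList (take (suc m) (props ℘)) q)
  take-suc (x ∷ ℘) zero    _         = prop x , λ q → sym (∨-identityʳ _)
  take-suc (x ∷ ℘) (suc m) (s≤s m<n) with take-suc ℘ m m<n
  ... | p , eq = p , λ q → trans (∨-assoc (does (q ≟ prop x)) _ _) (cong (does (q ≟ prop x) ∨_) (eq q))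

  move-exists : ∀ {℘} (v : Position ℘) → ∃[ v′ ] Move v v′
  move-exists {℘} v with m≤n⇒m<n∨m≡n (size≤ v)
  ... | inj₂ full = emptyPosition , restart full refl
  ... | inj₁ m<n  with take-suc ℘ (size v) m<n
  ...   | p , eq = v′ , assign m<n refl extends
    where
    new : Maybe Bool → Bool → Maybe Bool
    new (just b) _     = just b
    new nothing  true  = just true
    new nothing  false = nothing

    is-just-new : ∀ m b → is-just (new m b) ≡ is-just m ∨ b
    is-just-new (just _) _     = refl
    is-just-new nothing  true  = refl
    is-just-new nothing  false = refl

    new-just : ∀ m b → T (is-just m) → new m b ≡ m
    new-just (just _) _ _ = refl

    v′ : Position ℘
    v′ = record
      { size  = suc (size v)
      ; size≤ = m<n
      ; val   = λ q → new (val v q) (does (q ≟ p))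
      ; val∈  = λ q → trans (is-just-new (val v q) _)
                        (trans (cong (_∨ does (q ≟ p)) (val∈ v q)) (eq q))
      }

    extends : ∀ q → T (is-just (val v q)) → val v′ q ≡ val v q
    extends q = new-just (val v q) _

  𝒢 : Prefix → Pred Assignment 0ℓ → Game
  𝒢 ℘ Ψ = record
    { Pos        = Position ℘
    ; owner      = λ v → turn (drop (size v) ℘)
    ; initial    = emptyPosition
    ; _⟶_        = Move
    ; successor  = move-exists
    ; Observable = λ v → size v ≡ length ℘
    ; Win        = λ u → (λ t → val (proj₁ (u t))) ∈ words Ψ
    }

{-# OPTIONS --safe #-}
module Submission where

-- Against an opponent who plays the assignment χ of his own propositions, a
-- strategy of the other player determines the value of each of her propositions
-- q in round k. This value depends on χ up to round k, and only on the rounds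
-- before k for propositions that come after q in the prefix, so it defines
-- functors that satisfy exactly the specifications of the canonical form.
-- Evolution preserves "some X ⊆ A" along ∃ and "every X meets A" along ∀ when A
-- is extended by an admissible functor. In the end A consists of assignments
-- which are observations of plays that follow the strategy. The initial block of
-- opponent quantifiers only has to preserve hyperassignments.

open import Defs
open import Axiom.ExcludedMiddle using (ExcludedMiddle)
open import Axiom.Extensionality.Propositional using (Extensionality)
open import Data.Bool.Base using (Bool; true; false; T; if_then_else_; _∨_)
open import Data.Bool.Properties using (T?; T-≡; ¬-not; ∨-identityʳ; ∨-assoc)
open import Data.List.Base
  using (List; []; _∷_; _++_; concatMap; foldl; reverse; take; drop; length)
open import Data.List.NonEmpty.Base using (List⁺; toList)
open import Data.List.Properties using (++-assoc; map-++; map-∘; map-id; length-map; take-all)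
open import Data.List.Membership.Propositional renaming (_∈_ to _∈ˡ_; _∉_ to _∉ˡ_)
open import Data.List.Membership.Propositional.Properties
  using (∈-++⁺ˡ; ∈-++⁺ʳ; ∈-++⁻; ∈-map⁻; ∈-map⁺)
open import Data.List.Relation.Binary.Permutation.Propositional
  using (_↭_; ↭-refl; ↭-sym; ↭-trans; ↭-reflexive; ↭⇒↭ₛ; module PermutationReasoning)
open import Data.List.Relation.Binary.Permutation.Propositional.Properties
  using (++⁺ˡ; ++⁺ʳ; shifts; map⁺; ∈-resp-↭; ↭-reverse)
open import Data.List.Relation.Binary.Permutation.Setoid.Properties using (Unique-resp-↭)
open import Data.List.Relation.Unary.All as All using (All; []; _∷_)
open import Data.List.Relation.Unary.All.Properties as All using ()
open import Data.List.Relation.Unary.AllPairs.Core using (_∷_)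
open import Data.List.Relation.Unary.Any using (here; there)
open import Data.List.Relation.Unary.Unique.Propositional using (Unique)
open import Data.Maybe.Base as Maybe using (Maybe; just; nothing; is-just; fromMaybe; _<∣>_)
open import Data.Nat.Base using (ℕ; zero; suc; _+_; _*_; _≤_; _<_; z≤n; s≤s)
open import Data.Nat.DivMod using (_%_; [m+kn]%n≡m%n; m<n⇒m%n≡m)
open import Data.Maybe.Properties using (just-injective)
open import Data.Nat.Induction using (<-rec)
open import Data.Nat.Properties
open import Data.Product.Base using (∃; ∃-syntax; _×_; _,_; proj₁; proj₂)
open import Data.Sum.Base using (_⊎_; inj₁; inj₂)
open import Data.Unit.Base using (⊤; tt)
open import Function.Base using (_∘_; flip)
open import Function.Bundles using (Equivalence; mk⇔)
open import Level using (0ℓ)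
open import Relation.Binary.PropositionalEquality
  using (_≡_; _≢_; _≗_; refl; sym; trans; cong; cong₂; subst; module ≡-Reasoning)
open import Relation.Binary.PropositionalEquality.Properties using (setoid)
open import Relation.Nullary.Decidable
  using (Dec; yes; no; does; dec-true; dec-false; does-⇔; toWitness; fromWitness; isYes≗does)
open import Relation.Nullary.Negation using (¬_; contradiction)
open import Relation.Unary using (Pred; _∈_; _⊆_; _≐_)

-- Hyperassignments under duality and evolution.

module Evolution (em : ExcludedMiddle 0ℓ) (AP : Set) where

  open Hyper AP (λ _ _ → em)

  T-does : ∀ {P : Set} (P? : Dec P) → T (does P?) → P
  T-does (yes p) _ = p

  -- Excluded middle turns a predicate into its characteristic function, so that images under choice
  -- functions and functors exist as elements of `𝒫 A`.
  comprehension : {A : Set} → Pred A 0ℓ → 𝒫 A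
  comprehension B x = does (em {B x})

  comprehension-≐ : {A : Set} (B : Pred A 0ℓ) → ⟦ comprehension B ⟧ ≐ B
  comprehension-≐ B = (λ {x} → T-does em) , (λ {x} → from em)
    where
    from : ∀ {P : Set} (d : Dec P) → P → T (does d)
    from (yes _) _ = tt
    from (no ¬p) p = ¬p p

  infixl 6 _⊕_
  -- Written so that `fromList ps ⊕ p` and `fromList (p ∷ ps)` are definitionally equal, on which
  -- `evolve-hyper` relies.
  _⊕_ : 𝒫 AP → AP → 𝒫 AP
  (P ⊕ p) q = does (em {q ≡ p}) ∨ P q

  update-other : ∀ χ {p q} f → q ≢ p → (χ [ p ↦ f ]) q ≡ χ q
  update-other χ {p} {q} f q≢p = cong (if_then just f else χ q) (dec-false em q≢p)

  update-Asg : ∀ {P χ} p f → χ ∈ Asg P → (χ [ p ↦ f ]) ∈ Asg (P ⊕ p)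
  update-Asg p f χ∈ q with em {q ≡ p}
  ... | yes _ = refl
  ... | no  _ = χ∈ q

  open IsHyperassignment

  trivial-hyper : IsHyperassignment trivial (fromList [])
  trivial-hyper = record
    { over      = λ X≐ χ∈ p → cong (λ χ → dom χ p) (proj₁ X≐ χ∈)
    ; nonempty  = _ , comprehension-≐ (_≡ undefined)
    ; inhabited = λ X≐ → _ , proj₂ X≐ refl
    }

  -- Deciding the type of witnesses also returns one, so excluded middle supplies a choice function
  -- that prefers `A`. The default `undefined` is reached only if `X` misses `A`.
  choose : Pred Assignment 0ℓ → 𝒫 Assignment → Assignment
  choose A X with em {∃[ χ ] χ ∈ ⟦ X ⟧ × χ ∈ A}
  ... | yes (χ , _) = χ
  ... | no  _       = undefined

  choose-∈ : ∀ A X → (∃[ χ ] χ ∈ ⟦ X ⟧ × χ ∈ A) → choose A X ∈ ⟦ X ⟧ × choose A X ∈ A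
  choose-∈ A X meets with em {∃[ χ ] χ ∈ ⟦ X ⟧ × χ ∈ A}
  ... | yes (χ , χ∈) = χ∈
  ... | no  ¬meets   = contradiction meets ¬meets

  -- Take the image of the choice function that always picks a point of `A`. Together with
  -- `meets-dual` this exchanges the two ways of forcing under duality.
  dual-meets : ∀ {𝒳} A → (∀ X → X ∈ 𝒳 → ∃[ χ ] χ ∈ ⟦ X ⟧ × χ ∈ A) →
    ∃[ Y ] Y ∈ dual 𝒳 × ⟦ Y ⟧ ⊆ A
  dual-meets {𝒳} A meets = comprehension image
    , (choose A , (λ X X∈ → proj₁ (choose-∈ A X (meets X X∈))) , comprehension-≐ image)
    , λ Y∈ → let X , X∈ , χ≡ = proj₁ (comprehension-≐ image) Y∈ in
        subst A (sym χ≡) (proj₂ (choose-∈ A X (meets X X∈)))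
    where
    image : Pred Assignment 0ℓ
    image χ = ∃[ X ] X ∈ 𝒳 × χ ≡ choose A X

  -- Every choice function picks some point of the given `X`, and that point lies in `A`.
  meets-dual : ∀ {𝒳} {A : Pred Assignment 0ℓ} → (∃[ X ] X ∈ 𝒳 × ⟦ X ⟧ ⊆ A) →
    ∀ Y → Y ∈ dual 𝒳 → ∃[ χ ] χ ∈ ⟦ Y ⟧ × χ ∈ A
  meets-dual (X , X∈ , X⊆A) Y (c , chooses , _ , image⊆) =
    c X , image⊆ (X , X∈ , refl) , X⊆A (chooses X X∈)

  dual-hyper : ∀ {𝒳 P} → IsHyperassignment 𝒳 P → IsHyperassignment (dual 𝒳) P
  dual-hyper {𝒳} {P} hyper = record
    { over      = λ (c , chooses , Y⊆ , _) χ∈ →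
        let X , X∈ , χ≡ = Y⊆ χ∈ in
        subst (Asg P) (sym χ≡) (over hyper X∈ (chooses X X∈))
    -- With the full set as `A`, the two duality lemmas say that the dual is nonempty and that its
    -- members are inhabited.
    ; nonempty  = let Y , Y∈ , _ = dual-meets (λ _ → ⊤) everywhere in Y , Y∈
    ; inhabited = λ Y∈ →
        let X , X∈ = nonempty hyper
            χ , χ∈ , _ = meets-dual {A = λ _ → ⊤} (X , X∈ , λ _ → tt) _ Y∈
        in χ , χ∈
    }
    where
    everywhere : ∀ X → X ∈ 𝒳 → ∃[ χ ] χ ∈ ⟦ X ⟧ × ⊤
    everywhere X X∈ = let χ , χ∈ = inhabited hyper X∈ in χ , χ∈ , tt

  ext-image : 𝒫 Assignment → Functor → AP → Pred Assignment 0ℓ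
  ext-image X F p χ = ∃[ χ′ ] χ′ ∈ ⟦ X ⟧ × χ ≡ extend χ′ F p

  extSet : 𝒫 Assignment → Functor → AP → 𝒫 Assignment
  extSet X F p = comprehension (ext-image X F p)

  extSet-∈ : ∀ {σ 𝒳 P X F} p → IsHyperassignment 𝒳 P → X ∈ 𝒳 → F ∈ Fnc σ P →
    extSet X F p ∈ ext σ 𝒳 p
  extSet-∈ p hyper X∈ F∈ = _ , hyper , _ , _ , X∈ , F∈ , comprehension-≐ (ext-image _ _ p)

  ext-hyper : ∀ {σ 𝒳 P} p → IsHyperassignment 𝒳 P → IsHyperassignment (ext σ 𝒳 p) (P ⊕ p)
  ext-hyper {σ} {𝒳} {P} p hyper = record
    { over      = λ (_ , _ , X , F , X∈ , _ , Y⊆ , _) χ∈ →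
        let χ′ , χ′∈ , χ≡ = Y⊆ χ∈ in
        subst (Asg (P ⊕ p)) (sym χ≡) (update-Asg p (F χ′) (over hyper X∈ χ′∈))
    -- A constant functor satisfies every specification.
    ; nonempty  = extSet (proj₁ (nonempty hyper)) (λ _ _ → false) p
        , extSet-∈ {σ} p hyper (proj₂ (nonempty hyper))
            ((λ _ _ _ _ _ _ _ _ _ → refl) , (λ _ _ _ _ _ _ _ _ _ → refl))
    ; inhabited = λ (_ , _ , X , F , X∈ , _ , _ , ⊆Y) →
        let χ , χ∈ = inhabited hyper X∈ in _ , ⊆Y (χ , χ∈ , refl)
    }

  evolve₁-hyper : ∀ α {𝒳 P} q → IsHyperassignment 𝒳 P →
    IsHyperassignment (evolve₁ α 𝒳 q) (P ⊕ prop q)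
  evolve₁-hyper α (quant Q σ p) hyper with coherent α Q
  ... | true  = ext-hyper {σ} p hyper
  ... | false = dual-hyper (ext-hyper {σ} p (dual-hyper hyper))

  -- The fold pushes propositions in the order in which evolution adds them; started at `[]` it is
  -- `reverse`.
  evolve-hyper : ∀ α {𝒳} ps ℘ → IsHyperassignment 𝒳 (fromList ps) →
    IsHyperassignment (evolve α 𝒳 ℘) (fromList (foldl (flip _∷_) ps (props ℘)))
  evolve-hyper α ps []      hyper = hyper
  evolve-hyper α ps (q ∷ ℘) hyper = evolve-hyper α (prop q ∷ ps) ℘ (evolve₁-hyper α q hyper)

  evolve-++ : ∀ α 𝒳 ℘₁ ℘₂ → evolve α 𝒳 (℘₁ ++ ℘₂) ≡ evolve α (evolve α 𝒳 ℘₁) ℘₂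
  evolve-++ α 𝒳 []       ℘₂ = refl
  evolve-++ α 𝒳 (q ∷ ℘₁) ℘₂ = evolve-++ α (evolve₁ α 𝒳 q) ℘₁ ℘₂

  -- What the owner of the Q-quantifiers can enforce in the ∃∀-reading of 𝒳.
  Forces : Quantifier → Pred (𝒫 Assignment) 0ℓ → Pred Assignment 0ℓ → Set
  Forces ∃′ 𝒳 A = ∃[ X ] X ∈ 𝒳 × ⟦ X ⟧ ⊆ A
  Forces ∀′ 𝒳 A = ∀ X → X ∈ 𝒳 → ∃[ χ ] χ ∈ ⟦ X ⟧ × χ ∈ A

  hyper-forces : ∀ Q {𝒳 P A} → IsHyperassignment 𝒳 P → (∀ χ → χ ∈ A) → Forces Q 𝒳 A
  hyper-forces ∃′ hyper all = let X , X∈ = nonempty hyper in X , X∈ , λ {χ} _ → all χ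
  hyper-forces ∀′ hyper all X X∈ = let χ , χ∈ = inhabited hyper X∈ in χ , χ∈ , all χ

  -- For `∃′`, apply `F` to the witnessing set. For `∀′`, evolution passes through the dual: there
  -- some set lies inside `A`, the `∃′` case extends it by `F`, and dualising back makes every set
  -- meet `A′`.
  forces-evolve₁ : ∀ Q {𝒳 P A A′ σ p F} → IsHyperassignment 𝒳 P → F ∈ Fnc σ P →
    (∀ χ → χ ∈ A → extend χ F p ∈ A′) →
    Forces Q 𝒳 A → Forces Q (evolve₁ ∃∀ 𝒳 (quant Q σ p)) A′
  forces-evolve₁ ∃′ {A′ = A′} {σ} {p} {F} hyper F∈ step (X , X∈ , X⊆A) =
    extSet X F p , extSet-∈ {σ} p hyper X∈ F∈ , λ χ∈ →
      let χ′ , χ′∈ , χ≡ = proj₁ (comprehension-≐ (ext-image X F p)) χ∈ in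
      subst A′ (sym χ≡) (step χ′ (X⊆A χ′∈))
  forces-evolve₁ ∀′ {A = A} {A′} {σ} {p} {F} hyper F∈ step meets =
    meets-dual (forces-evolve₁ ∃′ {σ = σ} (dual-hyper hyper) F∈ step (dual-meets A meets))

  -- Forcing the values of prescribed functors.

  Settled : (AP → Functor) → List AP → Pred Assignment 0ℓ
  Settled F qs χ = ∀ q → q ∈ˡ qs → χ q ≡ just (F q χ)

  -- `respects` ranges over all `P` because the domain grows along the prefix. By `unaffected`,
  -- adding the value of `prop x` changes no functor, so values settled earlier stay correct at the
  -- final assignment.
  record Realised (Q : Quantifier) (F : AP → Functor) (x : Quantification) : Set where
    field
      kind≡      : kind x ≡ Q
      respects   : ∀ P → F (prop x) ∈ Fnc (spec x) P
      unaffected : ∀ q χ f → F q (χ [ prop x ↦ f ]) ≡ F q χ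
  open Realised

  settle : ∀ {Q F qs} x → Realised Q F x → ∀ χ → χ ∈ Settled F qs →
    extend χ (F (prop x)) (prop x) ∈ Settled F (prop x ∷ qs)
  settle {F = F} x r χ settled q q∈ with em {q ≡ prop x} | q∈
  ... | yes refl | _         = cong just (sym (unaffected r q χ _))
  ... | no  q≢x  | here q≡x  = contradiction q≡x q≢x
  ... | no  _    | there q∈′ = trans (settled q q∈′) (cong just (sym (unaffected r q χ _)))

  -- `ps` is the domain reached so far and `qs` its settled part; they differ because the leading
  -- block of the canonical form enters only `ps`.
  forces-evolve : ∀ {Q F 𝒳} ps qs ℘ → All (Realised Q F) ℘ →
    IsHyperassignment 𝒳 (fromList ps) → Forces Q 𝒳 (Settled F qs) →
    Forces Q (evolve ∃∀ 𝒳 ℘) (Settled F (foldl (flip _∷_) qs (props ℘)))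
  forces-evolve ps qs []      []       hyper forces = forces
  forces-evolve {Q} ps qs (x ∷ ℘) (r ∷ rs) hyper forces with kind≡ r
  ... | refl = forces-evolve (prop x ∷ ps) (prop x ∷ qs) ℘ rs
    (evolve₁-hyper ∃∀ x hyper)
    (forces-evolve₁ Q {σ = spec x} hyper (respects r _) (settle x r) forces)

-- Propositions and specifications of the canonical form.

module CanonicalForm (em : ExcludedMiddle 0ℓ) (AP : Set) where

  open Hyper AP (λ _ _ → em)
  open import Data.List.Membership.DecPropositional {A = AP} (λ _ _ → em) using (_∈?_)

  fromList-∈ : ∀ {p} ps → p ∈ ⟦ fromList ps ⟧ → p ∈ˡ ps
  fromList-∈ {p} ps t = toWitness (subst T (sym (isYes≗does (p ∈? ps))) t)

  ∈-fromList : ∀ {p} ps → p ∈ˡ ps → p ∈ ⟦ fromList ps ⟧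
  ∈-fromList {p} ps p∈ = subst T (isYes≗does (p ∈? ps)) (fromWitness p∈)

  fromList-↭ : ∀ {ps qs} → ps ↭ qs → fromList ps ≗ fromList qs
  fromList-↭ {ps} {qs} ps↭qs p =
    does-⇔ (mk⇔ (∈-resp-↭ ps↭qs) (∈-resp-↭ (↭-sym ps↭qs))) (p ∈? ps) (p ∈? qs)

  props-quantify : ∀ Q σ ps → props (quantify Q σ ps) ≡ ps
  props-quantify Q σ ps = trans (sym (map-∘ ps)) (map-id ps)

  following : List (List⁺ AP × List⁺ AP) → List AP
  following = concatMap (toList ∘ proj₁)

  leads trails : Blocks → List AP
  leads  (blocks first middle last) = first ++ leading middle
  trails (blocks first middle last) = following middle ++ last

  -- By induction, each block of the opposite quantifier is shifted behind all later blocks of `Q`.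
  -- This identifies the propositions of the canonical form with those of the prefix and sorts them
  -- by quantifier.
  alternate-↭ : ∀ Q bs →
    alternate Q bs ↭ quantify Q 𝖡 (leading bs) ++ quantify (opposite Q) 𝖡 (following bs)
  alternate-↭ Q []               = ↭-refl
  alternate-↭ Q ((ys , xs) ∷ bs) = begin
    (O (toList ys) ++ L (toList xs)) ++ alternate Q bs
      ↭⟨ ++⁺ˡ (O (toList ys) ++ L (toList xs)) (alternate-↭ Q bs) ⟩
    (O (toList ys) ++ L (toList xs)) ++ L (leading bs) ++ O (following bs)
      ≡⟨ ++-assoc (O (toList ys)) (L (toList xs)) _ ⟩
    O (toList ys) ++ L (toList xs) ++ L (leading bs) ++ O (following bs)
      ≡⟨ cong (O (toList ys) ++_) (++-assoc (L (toList xs)) _ _) ⟨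
    O (toList ys) ++ (L (toList xs) ++ L (leading bs)) ++ O (following bs)
      ↭⟨ shifts (O (toList ys)) (L (toList xs) ++ L (leading bs)) ⟩
    (L (toList xs) ++ L (leading bs)) ++ O (toList ys) ++ O (following bs)
      ≡⟨ cong₂ _++_ (map-++ _ (toList xs) _) (map-++ _ (toList ys) _) ⟨
    L (toList xs ++ leading bs) ++ O (toList ys ++ following bs) ∎
    where
    open PermutationReasoning
    L O : List AP → Prefix
    L = quantify Q 𝖡
    O = quantify (opposite Q) 𝖡

  assemble-↭ : ∀ Q b →
    assemble Q b ↭ quantify Q 𝖡 (leads b) ++ quantify (opposite Q) 𝖡 (trails b)
  assemble-↭ Q (blocks first middle last) = begin
    L first ++ alternate Q middle ++ O last
      ↭⟨ ++⁺ˡ (L first) (++⁺ʳ (O last) (alternate-↭ Q middle)) ⟩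
    L first ++ (L (leading middle) ++ O (following middle)) ++ O last
      ≡⟨ cong (L first ++_) (++-assoc (L (leading middle)) _ _) ⟩
    L first ++ L (leading middle) ++ O (following middle) ++ O last
      ≡⟨ ++-assoc (L first) _ _ ⟨
    (L first ++ L (leading middle)) ++ O (following middle) ++ O last
      ≡⟨ cong₂ _++_ (map-++ _ first _) (map-++ _ (following middle) _) ⟨
    L (first ++ leading middle) ++ O (following middle ++ last) ∎
    where
    open PermutationReasoning
    L O : List AP → Prefix
    L = quantify Q 𝖡
    O = quantify (opposite Q) 𝖡

  props-assemble : ∀ Q b → props (assemble Q b) ↭ leads b ++ trails b
  props-assemble Q b = ↭-trans (map⁺ prop (assemble-↭ Q b)) (↭-reflexive
    (trans (map-++ prop (quantify Q 𝖡 (leads b)) _)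
      (cong₂ _++_ (props-quantify Q 𝖡 (leads b)) (props-quantify (opposite Q) 𝖡 (trails b)))))

  assemble-∈ : ∀ Q b {x} → x ∈ˡ assemble Q b →
    (kind x ≡ Q × prop x ∈ˡ leads b) ⊎ (kind x ≡ opposite Q × prop x ∈ˡ trails b)
  assemble-∈ Q b x∈ with ∈-++⁻ (quantify Q 𝖡 (leads b)) (∈-resp-↭ (assemble-↭ Q b) x∈)
  ... | inj₁ x∈l with ∈-map⁻ (quant Q 𝖡) x∈l
  ...   | p , p∈ , refl = inj₁ (refl , p∈)
  assemble-∈ Q b x∈ | inj₂ x∈t with ∈-map⁻ (quant (opposite Q) 𝖡) x∈t
  ...   | p , p∈ , refl = inj₂ (refl , p∈)

  -- What follows the leading block in `canonical`; the functors of a strategy will realise it.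
  strategic : Quantifier → Blocks → Prefix
  strategic Q (blocks first middle last) =
    trailing Q middle ++ quantify (opposite Q) 𝖡 last

  props-trailing : ∀ Q bs → props (trailing Q bs) ≡ following bs
  props-trailing Q []                = refl
  props-trailing Q bs@((ys , _) ∷ bs′) = trans (map-++ prop (quantify (opposite Q) _ (toList ys)) _)
    (cong₂ _++_ (props-quantify (opposite Q) _ (toList ys)) (props-trailing Q bs′))

  props-strategic : ∀ Q b → props (strategic Q b) ≡ trails b
  props-strategic Q (blocks first middle last) = trans (map-++ prop (trailing Q middle) _)
    (cong₂ _++_ (props-trailing Q middle) (props-quantify (opposite Q) 𝖡 last))

  kinds-strategic : ∀ Q b → All (λ x → kind x ≡ opposite Q) (strategic Q b)
  kinds-strategic Q (blocks first middle last) =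
    All.++⁺ (kinds-trailing middle) (All.map⁺ (All.universal (λ _ → refl) last))
    where
    kinds-trailing : ∀ bs → All (λ x → kind x ≡ opposite Q) (trailing Q bs)
    kinds-trailing []              = []
    kinds-trailing ((ys , _) ∷ bs) =
      All.++⁺ (All.map⁺ (All.universal (λ _ → refl) (toList ys))) (kinds-trailing bs)

  -- Phrased as a cut of the list, since block boundaries provide exactly such cuts.
  Precedes : List AP → AP → AP → Set
  Precedes ps q p = ∃[ qs ] ∃[ rs ] ps ≡ qs ++ rs × q ∈ˡ qs × p ∈ˡ rs

  StrongLater : List AP → Quantification → Set
  StrongLater ps x = ∀ p → p ∈ ⟦ strong (spec x) ⟧ → Precedes ps (prop x) p

  leading-∈ : ∀ Q bs {p} → p ∈ˡ leading bs → p ∈ˡ props (alternate Q bs)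
  leading-∈ Q bs {p} p∈ = ∈-resp-↭ (map⁺ prop (↭-sym (alternate-↭ Q bs)))
    (subst (p ∈ˡ_) (sym (map-++ prop (quantify Q 𝖡 (leading bs)) _))
      (∈-++⁺ˡ (subst (p ∈ˡ_) (sym (props-quantify Q 𝖡 (leading bs))) p∈)))

  props-alternate : ∀ Q ys xs bs → props (alternate Q ((ys , xs) ∷ bs)) ≡
    toList ys ++ toList xs ++ props (alternate Q bs)
  props-alternate Q ys xs bs = begin
    props ((O (toList ys) ++ L (toList xs)) ++ alternate Q bs)
      ≡⟨ cong props (++-assoc (O (toList ys)) _ _) ⟩
    props (O (toList ys) ++ L (toList xs) ++ alternate Q bs)
      ≡⟨ map-++ prop (O (toList ys)) _ ⟩
    props (O (toList ys)) ++ props (L (toList xs) ++ alternate Q bs)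
      ≡⟨ cong₂ _++_ (props-quantify _ 𝖡 (toList ys)) (map-++ prop (L (toList xs)) _) ⟩
    toList ys ++ props (L (toList xs)) ++ props (alternate Q bs)
      ≡⟨ cong (λ r → toList ys ++ r ++ props (alternate Q bs)) (props-quantify Q 𝖡 (toList xs)) ⟩
    toList ys ++ toList xs ++ props (alternate Q bs) ∎
    where
    open ≡-Reasoning
    L O : List AP → Prefix
    L = quantify Q 𝖡
    O = quantify (opposite Q) 𝖡

  -- The strong part of the spec of `ys` consists of the leading propositions from `xs` onwards, so
  -- cutting the prefix just after `ys` separates them from `ys`. In the induction `qs` and `rs` are
  -- the parts of the prefix before and after `bs`.
  trailing-strong : ∀ Q {ps} qs bs rs → ps ≡ qs ++ props (alternate Q bs) ++ rs →
    All (StrongLater ps) (trailing Q bs)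
  trailing-strong Q qs []                    rs eq = []
  trailing-strong Q {ps} qs bs@((ys , xs) ∷ bs′) rs eq = All.++⁺
    (All.map⁺ (All.tabulate (λ q∈ p p∈ →
      _ , _ , split , ∈-++⁺ʳ qs q∈ , later (fromList-∈ (leading bs) p∈))))
    (trailing-strong Q ((qs ++ toList ys) ++ toList xs) bs′ rs
      (trans split (sym (++-assoc (qs ++ toList ys) (toList xs) _))))
    where
    split : ps ≡ (qs ++ toList ys) ++ toList xs ++ props (alternate Q bs′) ++ rs
    split = begin
      ps ≡⟨ eq ⟩
      qs ++ props (alternate Q bs) ++ rs
        ≡⟨ cong (λ r → qs ++ r ++ rs) (props-alternate Q ys xs bs′) ⟩
      qs ++ (toList ys ++ toList xs ++ props (alternate Q bs′)) ++ rs
        ≡⟨ cong (qs ++_) (++-assoc (toList ys) _ rs) ⟩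
      qs ++ toList ys ++ (toList xs ++ props (alternate Q bs′)) ++ rs
        ≡⟨ ++-assoc qs (toList ys) _ ⟨
      (qs ++ toList ys) ++ (toList xs ++ props (alternate Q bs′)) ++ rs
        ≡⟨ cong ((qs ++ toList ys) ++_) (++-assoc (toList xs) _ rs) ⟩
      (qs ++ toList ys) ++ toList xs ++ props (alternate Q bs′) ++ rs ∎
      where open ≡-Reasoning
    later : ∀ {p} → p ∈ˡ leading bs → p ∈ˡ toList xs ++ props (alternate Q bs′) ++ rs
    later p∈ with ∈-++⁻ (toList xs) p∈
    ... | inj₁ p∈xs = ∈-++⁺ˡ p∈xs
    ... | inj₂ p∈bs = ∈-++⁺ʳ (toList xs) (∈-++⁺ˡ (leading-∈ Q bs′ p∈bs))

  strategic-strong : ∀ Q b → All (StrongLater (props (assemble Q b))) (strategic Q b)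
  strategic-strong Q (blocks first middle last) = All.++⁺
    (trailing-strong Q (props (L first)) middle (props (O last))
      (trans (map-++ prop (L first) _)
        (cong (props (L first) ++_) (map-++ prop (alternate Q middle) _))))
    -- The last block has spec `𝖡`, whose strong part is empty.
    (All.map⁺ (All.universal (λ _ _ ()) last))
    where
    L O : List AP → Prefix
    L = quantify Q 𝖡
    O = quantify (opposite Q) 𝖡

  -- Indices of propositions in a list without repetitions.

  unique-disjoint : ∀ {ps qs : List AP} {p} → Unique (ps ++ qs) → p ∈ˡ ps → p ∉ˡ qs
  unique-disjoint {x ∷ ps} (x≢ ∷ _) (here refl) p∈qs = All.lookup x≢ (∈-++⁺ʳ ps p∈qs) refl
  unique-disjoint {x ∷ ps} (_ ∷ u)  (there p∈)  p∈qs = unique-disjoint u p∈ p∈qs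

  -- An absent proposition gets the index `length ps`, so bounds by the length hold for every
  -- proposition.
  index : List AP → AP → ℕ
  index []       q = 0
  index (p ∷ ps) q = if does (em {q ≡ p}) then 0 else suc (index ps q)

  index-≤ : ∀ ps q → index ps q ≤ length ps
  index-≤ []       q = z≤n
  index-≤ (p ∷ ps) q with em {q ≡ p}
  ... | yes _ = z≤n
  ... | no  _ = s≤s (index-≤ ps q)

  index-∈ : ∀ {qs q} rs → q ∈ˡ qs → index (qs ++ rs) q < length qs
  index-∈ {p ∷ qs} {q} rs q∈ with em {q ≡ p} | q∈
  ... | yes _  | _         = s≤s z≤n
  ... | no q≢p | here q≡p  = contradiction q≡p q≢p
  ... | no _   | there q∈′ = s≤s (index-∈ rs q∈′)

  index-∉ : ∀ qs {p} rs → p ∉ˡ qs → index (qs ++ rs) p ≡ length qs + index rs p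
  index-∉ []       rs p∉ = refl
  index-∉ (q ∷ qs) {p} rs p∉ with em {p ≡ q}
  ... | yes p≡q = contradiction (here p≡q) p∉
  ... | no  _   = cong suc (index-∉ qs rs (p∉ ∘ there))

  -- By uniqueness `p` does not occur before the cut, so its index is at least `length qs`.
  precedes-index : ∀ {ps q p} → Unique ps → Precedes ps q p → index ps q < index ps p
  precedes-index {p = p} u (qs , rs , refl , q∈ , p∈) = <-≤-trans (index-∈ rs q∈)
    (subst (length qs ≤_) (sym (index-∉ qs rs (λ p∈qs → unique-disjoint u p∈qs p∈)))
      (m≤m+n (length qs) (index rs p)))

-- Partial functions, words and arithmetic of time.

module Duel (em : ExcludedMiddle 0ℓ) (fe : Extensionality 0ℓ 0ℓ) (AP : Set) where

  open Hyper AP (λ _ _ → em)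
  open Evolution em AP
  open CanonicalForm em AP

  is-just-<∣> : ∀ {B : Set} (m : Maybe B) b c →
    is-just (m <∣> (if b then just c else nothing)) ≡ is-just m ∨ b
  is-just-<∣> (just _) b     c = refl
  is-just-<∣> nothing  true  c = refl
  is-just-<∣> nothing  false c = refl

  <∣>-just : ∀ {B : Set} (m m′ : Maybe B) → T (is-just m) → (m <∣> m′) ≡ m
  <∣>-just (just _) m′ _ = refl

  <∣>-nothing : ∀ {B : Set} (m m′ : Maybe B) → ¬ T (is-just m) → (m <∣> m′) ≡ m′
  <∣>-nothing (just _) m′ ¬t = contradiction tt ¬t
  <∣>-nothing nothing  m′ _  = refl

  is-just-false : ∀ {B : Set} (m : Maybe B) → is-just m ≡ false → m ≡ nothing
  is-just-false nothing _ = refl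

  just-fromMaybe : ∀ {B : Set} (m : Maybe B) c → T (is-just m) → m ≡ just (fromMaybe c m)
  just-fromMaybe (just _) c _ = refl

  dom-word : ∀ χ t p → dom (word χ t) p ≡ dom χ p
  dom-word χ t p with χ p
  ... | just _  = refl
  ... | nothing = refl

  word-injective : ∀ {χ χ′} → word χ ≡ word χ′ → χ ≡ χ′
  word-injective {χ} {χ′} eq =
    fe λ p → same (χ p) (χ′ p) (λ t → cong (λ u → u t p) eq)
    where
    same : (m m′ : Maybe Temporal) →
      (∀ t → Maybe.map (λ f → f t) m ≡ Maybe.map (λ f → f t) m′) → m ≡ m′
    same (just f) (just f′) eqs = cong just (fe λ t → just-injective (eqs t))
    same nothing  nothing   _   = refl
    same (just _) nothing   eqs with eqs 0
    ... | ()
    same nothing  (just _)  eqs with eqs 0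
    ... | ()

  -- Digits in base `suc n` are unique: the remainder recovers the lower one and cancellation the
  -- upper one.
  mixed-radix : ∀ {n m m′ r r′} → m ≤ n → m′ ≤ n →
    m + r * suc n ≡ m′ + r′ * suc n → m ≡ m′ × r ≡ r′
  mixed-radix {n} {m} {m′} {r} {r′} m≤ m′≤ eq =
    m≡m′ , *-cancelʳ-≡ r r′ (suc n) (+-cancelˡ-≡ m _ _ (trans eq (cong (_+ r′ * suc n) (sym m≡m′))))
    where
    remainder : ∀ {m} r → m ≤ n → m ≡ (m + r * suc n) % suc n
    remainder {m} r m≤ = trans (sym (m<n⇒m%n≡m (s≤s m≤))) (sym ([m+kn]%n≡m%n m r (suc n)))
    m≡m′ : m ≡ m′
    m≡m′ = trans (remainder r m≤) (trans (cong (_% suc n) eq) (sym (remainder r′ m′≤)))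

  increasing-≤ : ∀ {e : ℕ → ℕ} → (∀ i → e i < e (suc i)) → ∀ i → i ≤ e i
  increasing-≤ inc zero    = z≤n
  increasing-≤ inc (suc i) = ≤-<-trans (increasing-≤ inc i) (inc i)

  -- A preimage `i` of `r` satisfies `i ≤ r`. If `i < r`, the induction hypothesis gives `e i ≡ i`,
  -- contradicting `e i ≡ r`.
  increasing-onto : ∀ {e : ℕ → ℕ} → (∀ i → e i < e (suc i)) → (∀ r → ∃[ i ] e i ≡ r) → ∀ r → e r ≡ r
  increasing-onto {e} inc onto = <-rec _ step
    where
    step : ∀ r → (∀ {i} → i < r → e i ≡ i) → e r ≡ r
    step r below with onto r
    ... | i , ei≡r with m≤n⇒m<n∨m≡n (subst (i ≤_) ei≡r (increasing-≤ inc i))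
    ...   | inj₂ refl = ei≡r
    ...   | inj₁ i<r  = contradiction (trans (sym (below i<r)) ei≡r) (<⇒≢ i<r)

  -- The quantification that is due at a position.

  next : ∀ ℘ {m} → m < length ℘ → Quantification
  next (x ∷ ℘) {zero}  _         = x
  next (x ∷ ℘) {suc m} (s≤s m<n) = next ℘ m<n

  next-∈ : ∀ ℘ {m} (m<n : m < length ℘) → next ℘ m<n ∈ˡ ℘
  next-∈ (x ∷ ℘) {zero}  _         = here refl
  next-∈ (x ∷ ℘) {suc m} (s≤s m<n) = there (next-∈ ℘ m<n)

  controller : Quantifier → Player
  controller ∃′ = Eloise
  controller ∀′ = Abelard

  turn-next : ∀ ℘ {m} (m<n : m < length ℘) → turn (drop m ℘) ≡ controller (kind (next ℘ m<n))
  turn-next (quant ∃′ _ _ ∷ ℘) {zero}  _         = refl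
  turn-next (quant ∀′ _ _ ∷ ℘) {zero}  _         = refl
  turn-next (x ∷ ℘)            {suc m} (s≤s m<n) = turn-next ℘ m<n

  fromList-next : ∀ ℘ {m} (m<n : m < length ℘) q →
    fromList (take m (props ℘)) q ∨ does (em {q ≡ prop (next ℘ m<n)})
      ≡ fromList (take (suc m) (props ℘)) q
  fromList-next (x ∷ ℘) {zero}  _         q = sym (∨-identityʳ _)
  fromList-next (x ∷ ℘) {suc m} (s≤s m<n) q =
    trans (∨-assoc (does (em {q ≡ prop x})) _ _)
      (cong (does (em {q ≡ prop x}) ∨_) (fromList-next ℘ m<n q))

  index-next : ∀ ℘ {m} (m<n : m < length ℘) → Unique (props ℘) →
    index (props ℘) (prop (next ℘ m<n)) ≡ m
  index-next (x ∷ ℘) {zero} _ _ with em {prop x ≡ prop x}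
  ... | yes _  = refl
  ... | no x≢x = contradiction refl x≢x
  index-next (x ∷ ℘) {suc m} (s≤s m<n) (x≢ ∷ u) with em {prop (next ℘ m<n) ≡ prop x}
  ... | yes eq = contradiction (sym eq) (All.lookup x≢ (∈-map⁺ prop (next-∈ ℘ m<n)))
  ... | no  _  = cong suc (index-next ℘ m<n u)

  -- Plays against an opponent with prescribed values.

  module Play (℘ : Prefix) (unique : Unique (props ℘)) (Ψ : Pred Assignment 0ℓ) where

    open Game (𝒢 ℘ Ψ)

    n : ℕ
    n = length ℘

    fill : (v : Position ℘) → size v < n → Bool → Position ℘
    fill v m<n b = record
      { size  = suc (size v)
      ; size≤ = m<n
      ; val   = λ q → val v q <∣> (if does (em {q ≡ prop (next ℘ m<n)}) then just b else nothing)
      ; val∈  = λ q → trans (is-just-<∣> (val v q) _ b)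
          (trans (cong (_∨ does (em {q ≡ prop (next ℘ m<n)})) (val∈ v q)) (fromList-next ℘ m<n q))
      }

    answer : (v : Position ℘) → (AP → Bool) → ∃[ v′ ] Move v v′
    answer v f with m≤n⇒m<n∨m≡n (size≤ v)
    ... | inj₂ full = emptyPosition , restart full refl
    ... | inj₁ m<n  = fill v m<n (f (prop (next ℘ m<n)))
                    , assign m<n refl (λ p → <∣>-just (val v p) _)

    -- Only the proposition due at `v` is consulted, and uniqueness makes its index `size v`.
    answer-cong : ∀ v {f f′} → (∀ p → index (props ℘) p ≡ size v → f p ≡ f′ p) →
      answer v f ≡ answer v f′
    answer-cong v agree with m≤n⇒m<n∨m≡n (size≤ v)
    ... | inj₂ full = refl
    ... | inj₁ m<n  = cong (λ b → fill v m<n b , assign m<n refl (λ p → <∣>-just (val v p) _))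
      (agree _ (index-next ℘ m<n unique))

    answer-new : ∀ v f (m<n : size v < n) → let p = prop (next ℘ m<n) in
      ¬ T (is-just (val v p)) → val (proj₁ (answer v f)) p ≡ just (f p)
    answer-new v f m<n new with m≤n⇒m<n∨m≡n (size≤ v)
    ... | inj₂ full = contradiction full (<⇒≢ m<n)
    ... | inj₁ m<n′ rewrite ≤-irrelevant m<n′ m<n =
      trans (<∣>-nothing (val v _) _ new)
        (cong (if_then just (f (prop (next ℘ m<n))) else nothing) (dec-true em refl))

    round elapsed : ∀ {v} → History v → ℕ
    round start                   = 0
    round (h ▷ assign _ _ _)      = round h
    round (h ▷ restart _ _)       = suc (round h)
    elapsed start   = 0
    elapsed (h ▷ _) = suc (elapsed h)

    -- A round takes `n` assignments and one restart, so `size v` and `round h` are the digits of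
    -- the elapsed time in base `suc n`.
    elapsed-≡ : ∀ {v} (h : History v) → elapsed h ≡ size v + round h * suc n
    elapsed-≡ start                    = refl
    elapsed-≡ (h ▷ assign _ size≡ _)   rewrite size≡ = cong suc (elapsed-≡ h)
    elapsed-≡ (_▷_ {v} h (restart full empty)) rewrite empty =
      cong suc (trans (elapsed-≡ h) (cong (_+ round h * suc n) full))

    instant : ∀ {v} (h : History v) m r → m ≤ n → elapsed h ≡ m + r * suc n →
      size v ≡ m × round h ≡ r
    instant {v} h m r m≤n eq = mixed-radix (size≤ v) m≤n (trans (sym (elapsed-≡ h)) eq)

    -- Throughout, g r p is the value that the opponent gives to p in round r.
    reply : (ℕ → AP → Bool) → ∀ {v} → History v → ∃[ v′ ] Move v v′
    reply g {v} h = answer v (g (round h))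

    -- With `abelard`, the pair of strategies in which player `a` follows `s` and the other player
    -- follows `reply g`; both players are thereby treated at once.
    eloise : (a : Player) → Strategy a → (ℕ → AP → Bool) → Strategy Eloise
    eloise Eloise  s g h eq = s h eq
    eloise Abelard s g h eq = reply g h

    abelard : (a : Player) → Strategy a → (ℕ → AP → Bool) → Strategy Abelard
    abelard Eloise  s g h eq = reply g h
    abelard Abelard s g h eq = s h eq

    move-opponent : ∀ a (s : Strategy a) g {v} (h : History v) o (eq : owner v ≡ o) → o ≢ a →
      respond (eloise a s g) (abelard a s g) h o eq ≡ reply g h
    move-opponent Eloise  s g h Eloise  eq o≢a = contradiction refl o≢a
    move-opponent Eloise  s g h Abelard eq o≢a = refl
    move-opponent Abelard s g h Eloise  eq o≢a = refl
    move-opponent Abelard s g h Abelard eq o≢a = contradiction refl o≢a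

    move-cong : ∀ a (s : Strategy a) {g g′} {v} (h : History v) o (eq : owner v ≡ o) → reply g h ≡ reply g′ h →
      respond (eloise a s g) (abelard a s g) h o eq ≡ respond (eloise a s g′) (abelard a s g′) h o eq
    move-cong Eloise  s h Eloise  eq same = refl
    move-cong Eloise  s h Abelard eq same = same
    move-cong Abelard s h Eloise  eq same = same
    move-cong Abelard s h Abelard eq same = refl

    module _ (self : Player) (σ : Strategy self) where

      histories : (ℕ → AP → Bool) → ℕ → ∃ History
      histories g = history (eloise self σ g) (abelard self σ g)

      run : (ℕ → AP → Bool) → ℕ → Position ℘
      run g = play (eloise self σ g) (abelard self σ g)

      elapsed-histories : ∀ g i → elapsed (proj₂ (histories g i)) ≡ i
      elapsed-histories g zero    = refl
      elapsed-histories g (suc i) = cong suc (elapsed-histories g i)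

      -- The value `g r p` is consulted at time `index (props ℘) p + r * suc n` at the earliest, so
      -- the history up to time `i` depends only on values with a smaller time.
      causal : ∀ {g g′} i →
        (∀ r p → index (props ℘) p + r * suc n < i → g r p ≡ g′ r p) →
        histories g i ≡ histories g′ i
      causal {g} {g′} zero    agree = refl
      -- First replace `g` by `g′` in the last move only, keeping the history; then replace the
      -- history by induction.
      causal {g} {g′} (suc i) agree = trans
        (cong (λ (m : ∃ (Move (run g i))) → proj₁ m , proj₂ (histories g i) ▷ proj₂ m)
          (move-cong self σ (proj₂ (histories g i)) (owner (run g i)) refl same))
        (cong (advance g′) (causal i λ r p before → agree r p (m<n⇒m<1+n before)))
        where
        advance : (ℕ → AP → Bool) → ∃ History → ∃ History
        advance g (v , h) =
          let v′ , m = respond (eloise self σ g) (abelard self σ g) h (owner v) refl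
          in v′ , h ▷ m
        same : reply g (proj₂ (histories g i)) ≡ reply g′ (proj₂ (histories g i))
        same = answer-cong (run g i) λ p index≡ → agree _ p (s≤s (≤-reflexive (begin
          index (props ℘) p + round (proj₂ (histories g i)) * suc n
            ≡⟨ cong (_+ round (proj₂ (histories g i)) * suc n) index≡ ⟩
          size (run g i) + round (proj₂ (histories g i)) * suc n
            ≡⟨ elapsed-≡ (proj₂ (histories g i)) ⟨
          elapsed (proj₂ (histories g i)) ≡⟨ elapsed-histories g i ⟩
          i ∎)))
          where open ≡-Reasoning

      -- Functors read off a strategy.

      module _ (given : List AP) where

        -- Only the opponent's propositions matter, so that the choices of the
        -- strategy's owner can be added to χ without changing the play.
        opponent : Assignment → ℕ → AP → Bool
        opponent χ r p = if fromList given p then fromMaybe false (word χ r p) else false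

        opponent-update : ∀ χ {p} f → p ∉ˡ given → opponent (χ [ p ↦ f ]) ≡ opponent χ
        opponent-update χ {p} f p∉ = fe λ r → fe λ q → pointwise r q (fromList given q) refl
          where
          pointwise : ∀ r q b → fromList given q ≡ b →
            (if b then fromMaybe false (word (χ [ p ↦ f ]) r q) else false)
              ≡ (if b then fromMaybe false (word χ r q) else false)
          pointwise r q false eq = refl
          pointwise r q true  eq = cong (fromMaybe false ∘ Maybe.map (λ f → f r))
            (update-other χ f λ { refl → p∉ (fromList-∈ given (subst T (sym eq) tt)) })

        -- The move that assigns `q` in round `r` starts at time `index (props ℘) q + r * suc n`;
        -- its result is read one step later. The default `false` covers a `q` that is undefined
        -- there.
        F : AP → Functor
        F q χ r = fromMaybe false (val (run (opponent χ) (suc (index (props ℘) q) + r * suc n)) q)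

        F-update : ∀ q χ {p} f → p ∉ˡ given → F q (χ [ p ↦ f ]) ≡ F q χ
        F-update q χ f p∉ = cong
          (λ g r → fromMaybe false (val (run g (suc (index (props ℘) q) + r * suc n)) q))
          (opponent-update χ f p∉)

        -- Outside `P` both assignments are undefined, so they agree on all propositions; only for
        -- `p` must the time lie in `R`.
        agree-opponent : ∀ {P p R χ₁ χ₂} → χ₁ ∈ Asg P → χ₂ ∈ Asg P → Agree P p R χ₁ χ₂ →
          ∀ r q → (q ≡ p → r ∈ R) → opponent χ₁ r q ≡ opponent χ₂ r q
        agree-opponent {P} {p} {R} {χ₁} {χ₂} χ₁∈ χ₂∈ (others , early) r q r∈ =
          cong (λ w → if fromList given q then fromMaybe false w else false) same
          where
          same : word χ₁ r q ≡ word χ₂ r q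
          same with em {q ≡ p}
          ... | yes refl = early r (r∈ refl)
          ... | no  q≢p with T? (P q)
          ...   | yes q∈ = cong (Maybe.map (λ f → f r)) (others q q∈ q≢p)
          ...   | no  q∉ = cong (Maybe.map (λ f → f r)) (trans (absent χ₁∈) (sym (absent χ₂∈)))
            where
            absent : ∀ {χ} → χ ∈ Asg P → χ q ≡ nothing
            absent χ∈ = is-just-false _ (trans (χ∈ q) (¬-not (q∉ ∘ T-≡ .Equivalence.from)))

        -- By causality `F q χ k` sees only the opponent's values up to its own move, so it suffices
        -- that `R` contains the rounds in which `p` comes no later than that move.
        F-agree : ∀ {P p R k χ₁ χ₂} q → χ₁ ∈ Asg P → χ₂ ∈ Asg P → Agree P p R χ₁ χ₂ →
          (∀ r → index (props ℘) p + r * suc n ≤ index (props ℘) q + k * suc n → r ∈ R) →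
          F q χ₁ k ≡ F q χ₂ k
        F-agree {k = k} q χ₁∈ χ₂∈ agree before = cong (λ H → fromMaybe false (val (proj₁ H) q))
          (causal (suc (index (props ℘) q) + k * suc n) λ { r p′ (s≤s early) →
            agree-opponent χ₁∈ χ₂∈ agree r p′ λ { refl → before r early } })

        -- Since indices are at most `n`, no move of a round after `k` comes before the move for `q`
        -- in round `k`.
        F-behavioral : ∀ P p q → Behavioral P p (F q)
        F-behavioral P p q k χ₁ χ₂ χ₁∈ χ₂∈ agree = F-agree {k = k} q χ₁∈ χ₂∈ agree λ r early →
          ≤-pred (*-cancelʳ-< (suc n) r (suc k) (begin-strict
            r * suc n                         ≤⟨ m≤n+m _ (index (props ℘) p) ⟩
            index (props ℘) p + r * suc n     ≤⟨ early ⟩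
            index (props ℘) q + k * suc n     <⟨ +-monoˡ-< (k * suc n) (s≤s (index≤n q)) ⟩
            suc k * suc n                     ∎))
          where
          open ≤-Reasoning
          index≤n : ∀ q → index (props ℘) q ≤ n
          index≤n q = subst (index (props ℘) q ≤_) (length-map prop ℘) (index-≤ (props ℘) q)

        -- If `q` precedes `p`, then `p` in round `k` is assigned after `q` in round `k`, so only
        -- earlier rounds of `p` are visible.
        F-strong : ∀ P p q → Precedes (props ℘) q p → StronglyBehavioral P p (F q)
        F-strong P p q q<p k χ₁ χ₂ χ₁∈ χ₂∈ agree = F-agree {k = k} q χ₁∈ χ₂∈ agree λ r early →
          *-cancelʳ-< (suc n) r k (+-cancelˡ-< (index (props ℘) q) _ _ (begin-strict
            index (props ℘) q + r * suc n     <⟨ +-monoˡ-< (r * suc n) (precedes-index unique q<p) ⟩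
            index (props ℘) p + r * suc n     ≤⟨ early ⟩
            index (props ℘) q + k * suc n     ∎))
          where open ≤-Reasoning

        -- The play against a settled assignment and its observation.

        module _ (own : Quantifier) (self≡ : controller own ≡ self)
          (given-opposite : ∀ {x} → x ∈ˡ ℘ → kind x ≢ own → prop x ∈ˡ given)
          (χ : Assignment) (χ∈ : χ ∈ Asg (ap ℘))
          (settled : ∀ {x} → x ∈ˡ ℘ → kind x ≡ own → χ (prop x) ≡ just (F (prop x) χ))
          where

          g : ℕ → AP → Bool
          g = opponent χ

          roundAt : ℕ → ℕ
          roundAt i = round (proj₂ (histories g i))

          word-defined : ∀ {x} r → x ∈ˡ ℘ → T (is-just (word χ r (prop x)))
          word-defined {x} r x∈ = subst T (sym (trans (dom-word χ r (prop x)) (χ∈ (prop x))))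
            (∈-fromList (props ℘) (∈-map⁺ prop x∈))

          -- Induction on time: a restart clears the valuation, while an assignment stays in the
          -- round, keeps the old values and adds one that agrees with `χ`.
          follows : ∀ i p → T (is-just (val (run g i) p)) → val (run g i) p ≡ word χ (roundAt i) p
          follows zero    p ()
          follows (suc i) =
            advance (respond (eloise self σ g) (abelard self σ g) h (owner v) refl) added
            where
            v : Position ℘
            v = run g i
            h : History v
            h = proj₂ (histories g i)

            -- Stated for an arbitrary `v′`, so that `advance` can match on the move while `added`
            -- asks who made it.
            Added : Position ℘ → Set
            Added v′ = (m<n : size v < n) → let p = prop (next ℘ m<n) in
              ¬ T (is-just (val v p)) → T (is-just (val v′ p)) → val v′ p ≡ word χ (round h) p

            added-next : ∀ v′ (m<n : size v < n) → size v′ ≡ suc (size v) →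
              ∀ {p} → ¬ T (is-just (val v p)) → T (is-just (val v′ p)) → p ≡ prop (next ℘ m<n)
            added-next v′ m<n size≡ {p} ¬old d = T-does em (subst T (begin
              is-just (val v′ p)                              ≡⟨ val∈ v′ p ⟩
              fromList (take (size v′) (props ℘)) p
                ≡⟨ cong (λ m → fromList (take m (props ℘)) p) size≡ ⟩
              fromList (take (suc (size v)) (props ℘)) p      ≡⟨ fromList-next ℘ m<n p ⟨
              fromList (take (size v) (props ℘)) p ∨ isNext   ≡⟨ cong (_∨ isNext) (val∈ v p) ⟨
              is-just (val v p) ∨ isNext
                ≡⟨ cong (_∨ isNext) (¬-not (¬old ∘ T-≡ .Equivalence.from)) ⟩
              isNext                                          ∎) d)
              where
              open ≡-Reasoning
              isNext : Bool
              isNext = does (em {p ≡ prop (next ℘ m<n)})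

            advance : ∀ (m : ∃ (Move v)) → Added (proj₁ m) → ∀ p → T (is-just (val (proj₁ m) p)) →
              val (proj₁ m) p ≡ word χ (round (h ▷ proj₂ m)) p
            advance (v′ , restart _ empty) _ p d = contradiction
              (subst T (trans (val∈ v′ p) (cong (λ m → fromList (take m (props ℘)) p) empty)) d) λ ()
            advance (v′ , assign m<n size≡ keep) new p d with T? (is-just (val v p))
            ... | yes old = trans (keep p old) (follows i p old)
            ... | no ¬old with added-next v′ m<n size≡ ¬old d
            ...   | refl = new m<n ¬old d

            owner≡ : (m<n : size v < n) → owner v ≡ controller (kind (next ℘ m<n))
            owner≡ = turn-next ℘

            added : Added (run g (suc i))
            added m<n new d with em {kind (next ℘ m<n) ≡ own}
            -- On a move of the strategy's owner, `now` identifies the present with the time at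
            -- which `F` reads this value, and `χ` is settled there.
            ... | yes mine = begin
              val (run g (suc i)) p                     ≡⟨ just-fromMaybe _ false d ⟩
              just (fromMaybe false (val (run g (suc i)) p))
                ≡⟨ cong (λ t → just (fromMaybe false (val (run g t) p))) now ⟩
              just (F p χ (round h))
                ≡⟨ cong (Maybe.map (λ f → f (round h))) (settled (next-∈ ℘ m<n) mine) ⟨
              word χ (round h) p                        ∎
              where
              open ≡-Reasoning
              p : AP
              p = prop (next ℘ m<n)
              now : suc i ≡ suc (index (props ℘) p) + round h * suc n
              now = cong suc (begin
                i                                       ≡⟨ elapsed-histories g i ⟨
                elapsed h                               ≡⟨ elapsed-≡ h ⟩
                size v + round h * suc n
                  ≡⟨ cong (_+ round h * suc n) (index-next ℘ m<n unique) ⟨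
                index (props ℘) p + round h * suc n     ∎)
            -- The opponent plays `opponent χ`, which has the values of `χ` on `given`.
            ... | no theirs = begin
              val (run g (suc i)) p
                ≡⟨ cong (λ m → val (proj₁ m) p) (move-opponent self σ g h (owner v) refl foreign) ⟩
              val (proj₁ (answer v (g (round h)))) p    ≡⟨ answer-new v (g (round h)) m<n new ⟩
              just (g (round h) p)
                ≡⟨ cong (λ b → just (if b then fromMaybe false (word χ (round h) p) else false)) p-given ⟩
              just (fromMaybe false (word χ (round h) p))
                ≡⟨ just-fromMaybe _ false (word-defined (round h) (next-∈ ℘ m<n)) ⟨
              word χ (round h) p                        ∎
              where
              open ≡-Reasoning
              p : AP
              p = prop (next ℘ m<n)
              p-given : fromList given p ≡ true
              p-given = T-≡ .Equivalence.to
                (∈-fromList given (given-opposite (next-∈ ℘ m<n) theirs))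
              controller-injective : ∀ {Q Q′} → controller Q ≡ controller Q′ → Q ≡ Q′
              controller-injective {∃′} {∃′} _ = refl
              controller-injective {∀′} {∀′} _ = refl
              foreign : owner v ≢ self
              foreign eq = theirs (controller-injective
                (trans (sym (owner≡ m<n)) (trans eq (sym self≡))))

          observed : ∀ i → size (run g i) ≡ n → val (run g i) ≡ word χ (roundAt i)
          observed i full = fe pointwise
            where
            all-defined : ∀ p → is-just (val (run g i) p) ≡ ap ℘ p
            all-defined p = trans (val∈ (run g i) p) (cong (λ ps → fromList ps p)
              (take-all _ (props ℘) (≤-reflexive (trans (length-map prop ℘) (sym full)))))
            pointwise : ∀ p → val (run g i) p ≡ word χ (roundAt i) p
            pointwise p with T? (is-just (val (run g i) p))
            ... | yes d = follows i p d
            ... | no ¬d = trans (is-just-false _ undef) (sym (is-just-false _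
              (trans (dom-word χ (roundAt i) p)
                (trans (χ∈ p) (trans (sym (all-defined p)) undef)))))
              where
              undef : is-just (val (run g i) p) ≡ false
              undef = ¬-not (¬d ∘ T-≡ .Equivalence.from)

          time-≡ : ∀ i → size (run g i) ≡ n → i ≡ n + roundAt i * suc n
          time-≡ i full = trans (sym (elapsed-histories g i))
            (trans (elapsed-≡ (proj₂ (histories g i))) (cong (_+ roundAt i * suc n) full))

          end-of-round : ∀ r → size (run g (n + r * suc n)) ≡ n × roundAt (n + r * suc n) ≡ r
          end-of-round r = instant (proj₂ (histories g (n + r * suc n))) n r ≤-refl
            (elapsed-histories g (n + r * suc n))

          -- Each round has one total position, so the rounds of the observed times increase
          -- strictly. By completeness every round is reached, hence the observation at `t` belongs
          -- to round `t`.
          observation-≡ : ∀ {u} → IsObservation (run g) u → (λ t → val (proj₁ (u t))) ≡ word χ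
          observation-≡ {u} (e , increasing , u≡ , complete) = fe λ t →
            trans (cong val (u≡ t)) (trans (observed (e t) (full t)) (cong (word χ) (round-≡ t)))
            where
            full : ∀ t → size (run g (e t)) ≡ n
            full t = trans (cong size (sym (u≡ t))) (proj₂ (u t))
            round-increasing : ∀ t → roundAt (e t) < roundAt (e (suc t))
            round-increasing t = *-cancelʳ-< (suc n) _ _ (+-cancelˡ-< n _ _ (begin-strict
              n + roundAt (e t) * suc n         ≡⟨ time-≡ (e t) (full t) ⟨
              e t                               <⟨ increasing t ⟩
              e (suc t)                         ≡⟨ time-≡ (e (suc t)) (full (suc t)) ⟩
              n + roundAt (e (suc t)) * suc n   ∎))
              where open ≤-Reasoning
            round-onto : ∀ r → ∃[ t ] roundAt (e t) ≡ r
            round-onto r =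
              let size≡ , round≡ = end-of-round r
                  t , et≡ = complete (n + r * suc n) size≡
              in t , trans (cong roundAt et≡) round≡
            round-≡ : ∀ t → roundAt (e t) ≡ t
            round-≡ = increasing-onto round-increasing round-onto

          observation : ∃[ u ] IsObservation (run g) u
          observation = (λ r → run g (n + r * suc n) , proj₁ (end-of-round r))
            , (λ r → n + r * suc n)
            , (λ r → +-monoʳ-< n (*-monoˡ-< (suc n) (n<1+n r)))
            , (λ _ → refl)
            , λ t full → roundAt t , sym (time-≡ t full)

          wins⇒∈ : ObservationWins (run g) → χ ∈ Ψ
          wins⇒∈ (u , is-observation , χ′ , χ′∈ , u≡) = subst Ψ
            (word-injective (trans (sym u≡) (observation-≡ {u} is-observation))) χ′∈

          ∈⇒wins : χ ∈ Ψ → ObservationWins (run g)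
          ∈⇒wins χ∈Ψ = let u , is-observation = observation in
            u , is-observation , χ , χ∈Ψ , observation-≡ {u} is-observation

  -- From winning strategies to the canonical forms.

  opposite-≢ : ∀ Q → opposite Q ≢ Q
  opposite-≢ ∃′ ()
  opposite-≢ ∀′ ()

  -- The canonical form permutes the propositions of the prefix, so the assignments it yields have
  -- the domain that the play requires.
  canonical-hyper : ∀ Q b →
    IsHyperassignment (evl ∃∀ (canonical Q b)) (ap (assemble Q b))
  canonical-hyper Q b = record
    { over      = λ X∈ χ∈ p → trans (over hyper X∈ χ∈ p) (fromList-↭ same p)
    ; nonempty  = nonempty hyper
    ; inhabited = inhabited hyper
    }
    where
    open IsHyperassignment
    hyper : IsHyperassignment (evl ∃∀ (canonical Q b)) (fromList (reverse (props (canonical Q b))))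
    hyper = evolve-hyper ∃∀ [] (canonical Q b) trivial-hyper
    same : reverse (props (canonical Q b)) ↭ props (assemble Q b)
    same = begin
      reverse (props (canonical Q b))           ↭⟨ ↭-reverse (props (canonical Q b)) ⟩
      props (canonical Q b)
        ≡⟨ map-++ prop (quantify Q 𝖡 (leads b)) _ ⟩
      props (quantify Q 𝖡 (leads b)) ++ props (strategic Q b)
        ≡⟨ cong₂ _++_ (props-quantify Q 𝖡 (leads b)) (props-strategic Q b) ⟩
      leads b ++ trails b                       ↭⟨ props-assemble Q b ⟨
      props (assemble Q b)                      ∎
      where open PermutationReasoning

  module _ (Q : Quantifier) (b : Blocks) (unique : Unique (props (assemble Q b)))
    (Ψ : Pred Assignment 0ℓ)
    (σ : Game.Strategy (𝒢 (assemble Q b) Ψ) (controller (opposite Q))) where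

    open Game (𝒢 (assemble Q b) Ψ)
    open Play (assemble Q b) unique Ψ

    -- `Q` leads the canonical form, so the strategy belongs to Eloise for `∀′` and to Abelard for
    -- `∃′`.
    functors : AP → Functor
    functors = F (controller (opposite Q)) σ (leads b)

    trails-fresh : ∀ {p} → p ∈ˡ trails b → p ∉ˡ leads b
    trails-fresh p∈t p∈l = unique-disjoint
      (Unique-resp-↭ (setoid AP) (↭⇒↭ₛ (props-assemble Q b)) unique) p∈l p∈t

    realised : All (Realised (opposite Q) functors) (strategic Q b)
    realised = All.tabulate λ {x} x∈ → record
      { kind≡      = All.lookup (kinds-strategic Q b) x∈
      ; respects   = λ P → (λ p _ _ → F-behavioral _ σ (leads b) P p (prop x))
                         , (λ p p∈ _ → F-strong _ σ (leads b) P p (prop x)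
                             (All.lookup (strategic-strong Q b) x∈ p p∈))
      ; unaffected = λ q χ f → F-update _ σ (leads b) q χ f
          (trails-fresh (subst (prop x ∈ˡ_) (props-strategic Q b) (∈-map⁺ prop x∈)))
      }

    forces-settled : Forces (opposite Q) (evl ∃∀ (canonical Q b))
      (Settled functors (reverse (props (strategic Q b))))
    forces-settled = subst
      (λ 𝒳 → Forces (opposite Q) 𝒳 (Settled functors (reverse (props (strategic Q b)))))
      (sym (evolve-++ ∃∀ trivial (quantify Q 𝖡 (leads b)) (strategic Q b)))
      -- Initially nothing is settled, so the forced set is everything and the leading block need
      -- only yield a hyperassignment.
      (forces-evolve (reverse (props (quantify Q 𝖡 (leads b)))) [] (strategic Q b) realised leads-hyper
        (hyper-forces (opposite Q) leads-hyper λ _ _ ()))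
      where
      leads-hyper : IsHyperassignment (evl ∃∀ (quantify Q 𝖡 (leads b)))
        (fromList (reverse (props (quantify Q 𝖡 (leads b)))))
      leads-hyper = evolve-hyper ∃∀ [] (quantify Q 𝖡 (leads b)) trivial-hyper

    module _ {χ : Assignment} (χ∈ : χ ∈ Asg (ap (assemble Q b)))
      (settled : χ ∈ Settled functors (reverse (props (strategic Q b)))) where

      given-opposite : ∀ {x} → x ∈ˡ assemble Q b → kind x ≢ opposite Q → prop x ∈ˡ leads b
      given-opposite x∈ theirs with assemble-∈ Q b x∈
      ... | inj₁ (_ , p∈)     = p∈
      ... | inj₂ (kind≡ , _)  = contradiction kind≡ theirs

      own-settled : ∀ {x} → x ∈ˡ assemble Q b → kind x ≡ opposite Q →
        χ (prop x) ≡ just (functors (prop x) χ)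
      own-settled {x} x∈ mine with assemble-∈ Q b x∈
      ... | inj₁ (kind≡ , _) = contradiction (trans (sym mine) kind≡) (opposite-≢ Q)
      ... | inj₂ (_ , p∈)    = settled (prop x)
        (∈-resp-↭ (↭-sym (↭-reverse (props (strategic Q b))))
          (subst (prop x ∈ˡ_) (sym (props-strategic Q b)) p∈))

      outcome : ObservationWins (run _ σ (opponent _ σ (leads b) χ)) → χ ∈ Ψ
      outcome = wins⇒∈ _ σ (leads b) (opposite Q) refl given-opposite χ χ∈ own-settled

      outcome⁻¹ : χ ∈ Ψ → ObservationWins (run _ σ (opponent _ σ (leads b) χ))
      outcome⁻¹ = ∈⇒wins _ σ (leads b) (opposite Q) refl given-opposite χ χ∈ own-settled

  -- Each `χ` in `E` is the observation of the play in which Abelard's moves are read off `χ`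
  -- itself; Eloise wins that play, so `χ` lies in `Ψ`.
  eloise-wins : ∀ b → Unique (props (assemble ∀′ b)) → ∀ Ψ →
    Game.EloiseWins (𝒢 (assemble ∀′ b) Ψ) → ∃[ E ] (E ∈ evl ∃∀ (canonical ∀′ b) × ⟦ E ⟧ ⊆ Ψ)
  eloise-wins b unique Ψ (s , winning) =
    let E , E∈ , settled = forces-settled ∀′ b unique Ψ s in
    E , E∈ , λ χ∈ → outcome ∀′ b unique Ψ s
      (IsHyperassignment.over (canonical-hyper ∀′ b) E∈ χ∈) (settled χ∈) (winning _)

  -- Every `E` contains a settled `χ`, the observation of a play in which Eloise's moves are read
  -- off `χ`. If `χ` were in `Ψ`, she would win against a winning strategy.
  abelard-wins : ∀ b → Unique (props (assemble ∃′ b)) → ∀ Ψ →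
    Game.AbelardWins (𝒢 (assemble ∃′ b) Ψ) → ∀ E → E ∈ evl ∃∀ (canonical ∃′ b) → ¬ (⟦ E ⟧ ⊆ Ψ)
  abelard-wins b unique Ψ (t , winning) E E∈ E⊆Ψ =
    let χ , χ∈ , settled = forces-settled ∃′ b unique Ψ t E E∈ in
    winning _ (outcome⁻¹ ∃′ b unique Ψ t
      (IsHyperassignment.over (canonical-hyper ∃′ b) E∈ χ∈) settled (E⊆Ψ χ∈))

mainTheorem15 :
    (em : ExcludedMiddle 0ℓ) → Extensionality 0ℓ 0ℓ →
    (AP : Set) → let open Hyper AP (λ _ _ → em) in
    (℘ : Prefix) → IsBehavioral ℘ → Unique (props ℘) →
    (Ψ : Pred Assignment 0ℓ) → Ψ ⊆ Asg (ap ℘) → Borelian (ap ℘) Ψ →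
    (Game.EloiseWins (𝒢 ℘ Ψ) → ∃[ E ] (E ∈ evl ∃∀ (C ∀∃ ℘) × ⟦ E ⟧ ⊆ Ψ)) ×
    (Game.AbelardWins (𝒢 ℘ Ψ) → ∀ E → E ∈ evl ∃∀ (C ∃∀ ℘) → ¬ (⟦ E ⟧ ⊆ Ψ))
mainTheorem15 em fe AP ℘ beh unique Ψ _ _ =
    (λ wins → eloise-case (decompose ∀′ ℘) (assemble-decompose ∀′ beh) unique wins)
  , (λ wins → abelard-case (decompose ∃′ ℘) (assemble-decompose ∃′ beh) unique wins)
  where
  open Hyper AP (λ _ _ → em)
  open Duel em fe AP
  -- With the prefix as a variable equal to `assemble ∀′ b`, the equation can be matched with
  -- `refl`, which transports the game and its strategies.
  eloise-case : ∀ b {℘} → assemble ∀′ b ≡ ℘ → Unique (props ℘) →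
    Game.EloiseWins (𝒢 ℘ Ψ) → ∃[ E ] (E ∈ evl ∃∀ (canonical ∀′ b) × ⟦ E ⟧ ⊆ Ψ)
  eloise-case b refl unique = eloise-wins b unique Ψ
  abelard-case : ∀ b {℘} → assemble ∃′ b ≡ ℘ → Unique (props ℘) →
    Game.AbelardWins (𝒢 ℘ Ψ) → ∀ E → E ∈ evl ∃∀ (canonical ∃′ b) → ¬ (⟦ E ⟧ ⊆ Ψ)
  abelard-case b refl unique = abelard-wins b unique Ψ
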